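{- Let $(\Delta,G,\omega,\zeta)$ be a generalised voltage graph and let $\Gamma=\mathrm{GenCov}(\Delta,G,\omega,\zeta)$. Then $\Gamma$ is a simple graph if and only if for all darts $x\in D(\Delta)$ all of the following conditions hold: (1) $\zeta(x)h\zeta(x)^{ -1} \notin \omega(\mathrm{end}_\Delta x)$ for all $h \in \omega(\mathrm{beg}_\Delta x) \setminus \omega(x)$; (2) $\zeta(y)h\zeta(x)^{ -1} \notin \omega(\mathrm{end}_\Delta x)$ for all darts $y\ne x$ which are parallel to $x$ in $\Delta$ and for all $h\in \omega(\mathrm{beg}_\Delta x)$; (3) $\zeta(x)\notin \omega(x)$ if $x=x^{ -1}$.
   Context: Graphs. A graph is a quadruple $(V,D,\mathrm{beg},\mathrm{inv})$ where $V$ is a non-empty set of vertices, $D$ is a set of darts (disjoint from $V$), $\mathrm{beg}\colon D\to V$, and $\mathrm{inv}\colon D\to D$ satisfies $\mathrm{inv}\,\mathrm{inv}\,x=x$ for all $x\in D$. For $\Gamma=(V,D,\mathrm{beg},\mathrm{inv})$ write $V(\Gamma)=V$, $D(\Gamma)=D$, $\mathrm{beg}_\Gamma=\mathrm{beg}$, $\mathrm{inv}_\Gamma=\mathrm{inv}$; also $x^{ -1}:=\mathrm{inv}\,x$ and $\mathrm{end}_\Gamma x=\mathrm{end}\,x:=\mathrm{beg}\,x^{ -1}$. Two darts $x,y$ are parallel if $\mathrm{beg}\,x=\mathrm{beg}\,y$ and $\mathrm{end}\,x=\mathrm{end}\,y$. An edge is a pair $\{x,x^{ -1}\}$ with $x$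 a dart, with endvertices $\mathrm{beg}\,x$ and $\mathrm{end}\,x$; it is a semi-edge if $x=x^{ -1}$ and a loop if $x\neq x^{ -1}$ but $\mathrm{beg}\,x=\mathrm{end}\,x$. Two distinct edges are parallel if they have the same endvertices. A graph is simple if it has no semi-edges, no loops and no pairs of distinct parallel edges. A graph is connected if any two vertices are joined by a walk, i.e. a sequence of darts $(x_1,\dots,x_n)$ with $\mathrm{end}\,x_i=\mathrm{beg}\,x_{i+1}$ (length $0$ allowed). Generalised voltage graphs. For a group $G$, $S(G)$ is the set of all subgroups of $G$, and $g^h:=h^{ -1}gh$, $H^h:=h^{ -1}Hh$. A generalised voltage graph is a quadruple $(\Delta,G,\omega,\zeta)$ where $\Delta$ is a connected graph, $G$ is a group, and $\omega\colon V(\Delta)\cup D(\Delta)\to S(G)$ and $\zeta\colon D(\Delta)\to G$ satisfy, for all $x\in D(\Delta)$: $\omega(x)\le\omega(\mathrm{beg}_\Delta x)$; $\omega(x)=\omega(x^{ -1})^{\zeta(x)}$; and $\zeta(x^{ -1})\zeta(x)\in\omega(x)$. Generalised cover. $\mathrm{GenCov}(\Delta,G,\omega,\zeta)$ is the graph $\Gamma$ with $V(\Gamma)=\{(v,\omega(v)g): v\in V(\Delta), g\in G\}$, $D(\Gamma)=\{(x,\omega(x)g): x\in D(\Delta), g\in G\}$, $\mathrm{beg}_\Gamma(x,\omega(x)g)=(\mathrm{beg}_\Delta x,\omega(\mathrm{beg}_\Delta x)g)$ and $\mathrm{inv}_\Gamma(x,\omega(x)g)=(x^{ -1},\omega(x^{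 -1})\zeta(x)g)$ (right cosets). -}

module Defs where

open import Level using (Level; _⊔_; suc)
open import Algebra.Bundles using (Group)
open import Data.Product using (_×_; _,_; ∃; proj₁; proj₂)
open import Data.Sum using (_⊎_)
open import Relation.Binary.Bundles using (Setoid)
open import Relation.Binary.Definitions using (_Respects_)
open import Relation.Nullary using (¬_)
open import Relation.Unary using (Pred; _∈_; _⊆_; _≐_)
open import Relation.Unary.Properties using (≐-refl; ≐-sym; ≐-trans)
import Algebra.Properties.Group as GroupProperties
import Relation.Binary.Reasoning.Setoid as ≈-Reasoning

private
  variable
    v ℓv d ℓd c ℓ p : Level

-- Vertices and darts form setoids, because those of a generalised cover are
-- cosets, i.e. representatives up to an equivalence.
record Graph (v ℓv d ℓd : Level) : Set (suc (v ⊔ ℓv ⊔ d ⊔ ℓd)) where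
  field
    vertexSetoid : Setoid v ℓv
    dartSetoid   : Setoid d ℓd

  open Setoid vertexSetoid public
    using () renaming (Carrier to V; _≈_ to _≈ⱽ_)
  open Setoid dartSetoid public
    using () renaming (Carrier to D; _≈_ to _≈ᴰ_)

  field
    nonEmpty       : V
    beg            : D → V
    inv            : D → D
    beg-cong       : ∀ {x y} → x ≈ᴰ y → beg x ≈ⱽ beg y
    inv-cong       : ∀ {x y} → x ≈ᴰ y → inv x ≈ᴰ inv y
    inv-involutive : ∀ x → inv (inv x) ≈ᴰ x

  end : D → V
  end x = beg (inv x)

  Parallel : D → D → Set ℓv
  Parallel x y = beg x ≈ⱽ beg y × end x ≈ⱽ end y

  -- The edge { x , x⁻¹ } as a subset of the darts; every edge is of this
  -- form, so properties of edges are stated on a representing dart.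
  edge : D → Pred D ℓd
  edge x y = y ≈ᴰ x ⊎ y ≈ᴰ inv x

  endvertices : D → Pred V ℓv
  endvertices x u = u ≈ⱽ beg x ⊎ u ≈ⱽ end x

  IsSemiEdge : D → Set ℓd
  IsSemiEdge x = x ≈ᴰ inv x

  IsLoop : D → Set (ℓv ⊔ ℓd)
  IsLoop x = ¬ (x ≈ᴰ inv x) × beg x ≈ⱽ end x

  DistinctParallelEdges : D → D → Set (v ⊔ ℓv ⊔ d ⊔ ℓd)
  DistinctParallelEdges x y =
    ¬ (edge x ≐ edge y) × endvertices x ≐ endvertices y

  Simple : Set (v ⊔ ℓv ⊔ d ⊔ ℓd)
  Simple = (∀ x → ¬ IsSemiEdge x)
         × (∀ x → ¬ IsLoop x)
         × (∀ x y → ¬ DistinctParallelEdges x y)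

  data Walk : V → V → Set (v ⊔ ℓv ⊔ d) where
    []   : ∀ {u w} → u ≈ⱽ w → Walk u w
    step : ∀ {u w} (x : D) → u ≈ⱽ beg x → Walk (end x) w → Walk u w

  Connected : Set (v ⊔ ℓv ⊔ d)
  Connected = ∀ u w → Walk u w

module _ (G : Group c ℓ) where
  open Group G

  record Subgroup (p : Level) : Set (c ⊔ ℓ ⊔ suc p) where
    field
      ∣_∣       : Pred Carrier p
      respects  : ∣_∣ Respects _≈_
      ε-closed  : ε ∈ ∣_∣
      ∙-closed  : ∀ {g h} → g ∈ ∣_∣ → h ∈ ∣_∣ → g ∙ h ∈ ∣_∣
      ⁻¹-closed : ∀ {g} → g ∈ ∣_∣ → g ⁻¹ ∈ ∣_∣

open Subgroup public using (∣_∣)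

module Cosets (G : Group c ℓ) where
  open Group G
  open GroupProperties G using (\\-leftDividesˡ; \\-leftDividesʳ)
  open ≈-Reasoning setoid

  infix 8 _^_ _·_

  -- H ^ g = g⁻¹ H g
  _^_ : Subgroup G p → Carrier → Pred Carrier (c ⊔ ℓ ⊔ p)
  (H ^ g) k = ∃ λ h → h ∈ ∣ H ∣ × k ≈ g ⁻¹ ∙ h ∙ g

  -- the right coset H g
  _·_ : Subgroup G p → Carrier → Pred Carrier (c ⊔ ℓ ⊔ p)
  (H · g) k = ∃ λ h → h ∈ ∣ H ∣ × k ≈ h ∙ g

  ∈-self : (H : Subgroup G p) (g : Carrier) → g ∈ H · g
  ∈-self H g = ε , Subgroup.ε-closed H , sym (identityˡ g)

  ∈-swap : (H : Subgroup G p) {g k : Carrier} → g ∈ H · k → k ∈ H · g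
  ∈-swap H {g} {k} (h , h∈H , g≈hk) =
    h ⁻¹ , Subgroup.⁻¹-closed H h∈H ,
    sym (trans (∙-congˡ g≈hk) (\\-leftDividesʳ h k))

  ·-mono : (H K : Subgroup G p) {g k : Carrier} →
           ∣ H ∣ ⊆ ∣ K ∣ → g ∈ K · k → H · g ⊆ K · k
  ·-mono H K {g} {k} H⊆K (h′ , h′∈K , g≈h′k) (h , h∈H , m≈hg) =
    h ∙ h′ , Subgroup.∙-closed K (H⊆K h∈H) h′∈K ,
    trans m≈hg (trans (∙-congˡ g≈h′k) (sym (assoc h h′ k)))

  -- z maps the coset K g into the coset H z g when K ⊆ z⁻¹ H z
  conj-shift : (H K : Subgroup G p) {z z′ g k : Carrier} →
               ∣ K ∣ ⊆ H ^ z → z′ ≈ z → g ∈ K · k → z′ ∙ g ∈ H · (z ∙ k)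
  conj-shift H K {z} {z′} {g} {k} K⊆Hᶻ z′≈z (a , a∈K , g≈ak)
    with h , h∈H , a≈z⁻¹hz ← K⊆Hᶻ a∈K = h , h∈H , (begin
      z′ ∙ g                      ≈⟨ ∙-cong z′≈z g≈ak ⟩
      z ∙ (a ∙ k)                 ≈⟨ assoc z a k ⟨
      (z ∙ a) ∙ k                 ≈⟨ ∙-congʳ (∙-congˡ a≈z⁻¹hz) ⟩
      (z ∙ (z ⁻¹ ∙ h ∙ z)) ∙ k    ≈⟨ ∙-congʳ (∙-congˡ (assoc (z ⁻¹) h z)) ⟩
      (z ∙ (z ⁻¹ ∙ (h ∙ z))) ∙ k  ≈⟨ ∙-congʳ (\\-leftDividesˡ z (h ∙ z)) ⟩
      (h ∙ z) ∙ k                 ≈⟨ assoc h z k ⟩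
      h ∙ (z ∙ k)                 ∎)

-- Since V and D are disjoint, ω : V ∪ D → S(G) is a pair of maps ωⱽ, ωᴰ.
record GenVoltageGraph
       (Δ : Graph v ℓv d ℓd) (G : Group c ℓ) (p : Level)
       : Set (v ⊔ ℓv ⊔ d ⊔ ℓd ⊔ c ⊔ ℓ ⊔ suc p) where
  open Graph Δ
  open Group G using (Carrier; _∙_; _≈_)
  open Cosets G using (_^_)
  field
    connected : Connected
    ωⱽ        : V → Subgroup G p
    ωᴰ        : D → Subgroup G p
    ζ         : D → Carrier
    ωⱽ-cong   : ∀ {u w} → u ≈ⱽ w → ∣ ωⱽ u ∣ ≐ ∣ ωⱽ w ∣
    ωᴰ-cong   : ∀ {x y} → x ≈ᴰ y → ∣ ωᴰ x ∣ ≐ ∣ ωᴰ y ∣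
    ζ-cong    : ∀ {x y} → x ≈ᴰ y → ζ x ≈ ζ y
    ω-beg     : ∀ x → ∣ ωᴰ x ∣ ⊆ ∣ ωⱽ (beg x) ∣
    ω-conj    : ∀ x → ∣ ωᴰ x ∣ ≐ ωᴰ (inv x) ^ ζ x
    ζ-inv     : ∀ x → ζ (inv x) ∙ ζ x ∈ ∣ ωᴰ x ∣

module _ {Δ : Graph v ℓv d ℓd} {G : Group c ℓ} (𝒱 : GenVoltageGraph Δ G p) where
  open Graph Δ
  open GenVoltageGraph 𝒱
  open Group G using (Carrier; _∙_; ε; sym; assoc)
  open Cosets G

  -- (a , g) represents (a , ω(a) g)
  cosetSetoid : {a ℓa : Level} (S : Setoid a ℓa) →
                (Setoid.Carrier S → Subgroup G p) →
                Setoid (a ⊔ c) (ℓa ⊔ c ⊔ ℓ ⊔ p)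
  cosetSetoid S ω = record
    { Carrier       = S.Carrier × Carrier
    ; _≈_           = λ (a , g) (b , k) → a S.≈ b × ω a · g ≐ ω b · k
    ; isEquivalence = record
      { refl  = S.refl , ≐-refl
      ; sym   = λ (p , q) → S.sym p , ≐-sym q
      ; trans = λ (p , q) (p′ , q′) → S.trans p p′ , ≐-trans q q′
      }
    }
    where module S = Setoid S

  GenCov : Graph (v ⊔ c) (ℓv ⊔ c ⊔ ℓ ⊔ p) (d ⊔ c) (ℓd ⊔ c ⊔ ℓ ⊔ p)
  GenCov = record
    { vertexSetoid   = cosetSetoid vertexSetoid ωⱽ
    ; dartSetoid     = cosetSetoid dartSetoid ωᴰ
    ; nonEmpty       = nonEmpty , ε
    ; beg            = λ (x , g) → beg x , g
    ; inv            = λ (x , g) → inv x , ζ x ∙ g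
    ; beg-cong       = λ (x≈y , eq) →
        beg-cong x≈y , beg-⊆ x≈y (proj₁ eq) , beg-⊆ (D.sym x≈y) (proj₂ eq)
    ; inv-cong       = λ (x≈y , eq) →
        inv-cong x≈y , inv-⊆ x≈y (proj₁ eq) , inv-⊆ (D.sym x≈y) (proj₂ eq)
    ; inv-involutive = λ (x , g) →
        inv-involutive x ,
        ·-mono (ωᴰ (inv (inv x))) (ωᴰ x)
          (proj₁ (ω-invinv x)) (ζζg∈ x g) ,
        ·-mono (ωᴰ x) (ωᴰ (inv (inv x)))
          (proj₂ (ω-invinv x))
          (∈-swap (ωᴰ (inv (inv x)))
            (weaken (ωᴰ x) (ωᴰ (inv (inv x))) (proj₂ (ω-invinv x)) (ζζg∈ x g)))
    }
    where
    module D = Setoid dartSetoid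

    weaken : (H K : Subgroup G p) {g k : Carrier} →
             ∣ H ∣ ⊆ ∣ K ∣ → g ∈ H · k → g ∈ K · k
    weaken H K H⊆K (h , h∈H , eq) = h , H⊆K h∈H , eq

    beg-⊆ : ∀ {x y g k} → x ≈ᴰ y → ωᴰ x · g ⊆ ωᴰ y · k →
            ωⱽ (beg x) · g ⊆ ωⱽ (beg y) · k
    beg-⊆ {x} {y} {g} {k} x≈y sub =
      ·-mono (ωⱽ (beg x)) (ωⱽ (beg y)) (proj₁ (ωⱽ-cong (beg-cong x≈y)))
        (weaken (ωᴰ y) (ωⱽ (beg y)) (ω-beg y) (sub (∈-self (ωᴰ x) g)))

    inv-⊆ : ∀ {x y g k} → x ≈ᴰ y → ωᴰ x · g ⊆ ωᴰ y · k →
            ωᴰ (inv x) · (ζ x ∙ g) ⊆ ωᴰ (inv y) · (ζ y ∙ k)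
    inv-⊆ {x} {y} {g} {k} x≈y sub =
      ·-mono (ωᴰ (inv x)) (ωᴰ (inv y)) (proj₁ (ωᴰ-cong (inv-cong x≈y)))
        (conj-shift (ωᴰ (inv y)) (ωᴰ y) (proj₁ (ω-conj y)) (ζ-cong x≈y)
          (sub (∈-self (ωᴰ x) g)))

    ω-invinv : ∀ x → ∣ ωᴰ (inv (inv x)) ∣ ≐ ∣ ωᴰ x ∣
    ω-invinv x = ωᴰ-cong (inv-involutive x)

    ζζg∈ : ∀ x g → ζ (inv x) ∙ (ζ x ∙ g) ∈ ωᴰ x · g
    ζζg∈ x g = ζ (inv x) ∙ ζ x , ζ-inv x , sym (assoc (ζ (inv x)) (ζ x) g)

{-# OPTIONS --safe #-}

-- A graph is simple if and only if it has no semi-edges and any two parallel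
-- darts coincide (a loop is a dart parallel to its inverse).  A dart of the
-- cover parallel to (x , ω(x)g) is of the form (y , ω(y)hg) with y parallel to x
-- in Δ, h ∈ ω(beg x) and ζ(y)hζ(x)⁻¹ ∈ ω(end x), so (1) and (2) express the
-- coincidence of parallel darts for y = x and y ≠ x respectively, and (3) the
-- absence of semi-edges.  Equality of darts is not decidable, so coincidence is
-- only available, and only needed, up to double negation.
module Submission where

open import Defs
open import Level using (Level; _⊔_)
open import Algebra.Bundles using (Group)
open import Data.Product using (_×_; _,_; ∃; proj₁; proj₂)
open import Data.Sum using (_⊎_; inj₁; inj₂; [_,_])
open import Function.Base using (_∘_)
open import Function.Bundles using (_⇔_; mk⇔)
open import Relation.Binary.Bundles using (Setoid)
open import Relation.Nullary using (¬_)
open import Relation.Unary using (_∈_; _∉_; _∖_; _⊆_; _≐_)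
import Algebra.Properties.Group as GroupProperties
import Relation.Binary.Reasoning.Setoid as ≈-Reasoning

private
  variable
    v ℓv d ℓd c ℓ p : Level

module _ (Γ : Graph v ℓv d ℓd) where
  open Graph Γ
  private
    module V = Setoid vertexSetoid
    module D = Setoid dartSetoid

  ParallelDartsCoincide : Set (ℓv ⊔ d ⊔ ℓd)
  ParallelDartsCoincide = ∀ x y → Parallel x y → ¬ ¬ (x ≈ᴰ y)

  end-inv : ∀ x → end (inv x) ≈ⱽ beg x
  end-inv x = beg-cong (inv-involutive x)

  edge-⊆ : ∀ {x y} → x ∈ edge y → edge x ⊆ edge y
  edge-⊆ (inj₁ x≈y)   (inj₁ z≈x)   = inj₁ (D.trans z≈x x≈y)
  edge-⊆ (inj₁ x≈y)   (inj₂ z≈x⁻¹) = inj₂ (D.trans z≈x⁻¹ (inv-cong x≈y))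
  edge-⊆ (inj₂ x≈y⁻¹) (inj₁ z≈x)   = inj₂ (D.trans z≈x x≈y⁻¹)
  edge-⊆ (inj₂ x≈y⁻¹) (inj₂ z≈x⁻¹) =
    inj₁ (D.trans z≈x⁻¹ (D.trans (inv-cong x≈y⁻¹) (inv-involutive _)))

  edge-sym : ∀ {x y} → x ∈ edge y → y ∈ edge x
  edge-sym (inj₁ x≈y)   = inj₁ (D.sym x≈y)
  edge-sym (inj₂ x≈y⁻¹) =
    inj₂ (D.sym (D.trans (inv-cong x≈y⁻¹) (inv-involutive _)))

  edge-≐ : ∀ {x y} → x ∈ edge y → edge x ≐ edge y
  edge-≐ x∈y = edge-⊆ x∈y , edge-⊆ (edge-sym x∈y)

  Parallel⇒endvertices : ∀ {x y} → Parallel x y → endvertices x ≐ endvertices y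
  Parallel⇒endvertices (b , e) =
    (λ { (inj₁ q) → inj₁ (V.trans q b) ; (inj₂ q) → inj₂ (V.trans q e) }) ,
    (λ { (inj₁ q) → inj₁ (V.trans q (V.sym b))
       ; (inj₂ q) → inj₂ (V.trans q (V.sym e)) })

  -- The set of endvertices forgets orientation, so `x` can be matched only with `y` or with its
  -- inverse.
  endvertices⇒Parallel : ∀ {x y} → endvertices x ≐ endvertices y →
                         Parallel x y ⊎ Parallel x (inv y)
  endvertices⇒Parallel {x} {y} (x⊆y , y⊆x)
    with x⊆y {beg x} (inj₁ V.refl) | x⊆y {end x} (inj₂ V.refl)
  ... | inj₁ b  | inj₂ e  = inj₁ (b , e)
  ... | inj₂ b  | inj₁ e  = inj₂ (b , V.trans e (V.sym (end-inv y)))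
  -- Both ends of `x` fall on `beg y`. The reverse inclusion puts `end y` on one of them, so all
  -- four vertices agree. The last case is the mirror image.
  ... | inj₁ b  | inj₁ e  with y⊆x {end y} (inj₂ V.refl)
  ...   | inj₁ e′ = inj₁ (b , V.trans e (V.trans (V.sym b) (V.sym e′)))
  ...   | inj₂ e′ = inj₁ (b , V.sym e′)
  endvertices⇒Parallel {x} {y} (x⊆y , y⊆x)
      | inj₂ b  | inj₂ e  with y⊆x {beg y} (inj₁ V.refl)
  ...   | inj₁ b′ = inj₁ (V.sym b′ , e)
  ...   | inj₂ b′ = inj₁ (V.trans b (V.trans (V.sym e) (V.sym b′)) , e)

  simple⇒coincide : Simple → ParallelDartsCoincide
  simple⇒coincide (noSemi , noLoop , noParallel) x y x∥y@(begs , _) x≉y =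
    noParallel x y (differentEdges , Parallel⇒endvertices x∥y)
    where
    -- Equal edges leave `x` equal to `y`, which is excluded, or to `inv y`; the latter, with equal
    -- beginnings, makes `y` a loop.
    differentEdges : ¬ (edge x ≐ edge y)
    differentEdges (x⊆y , _) =
      [ x≉y
      , (λ x≈y⁻¹ → noLoop y
          (noSemi y , V.trans (V.sym begs) (beg-cong x≈y⁻¹)))
      ] (x⊆y (inj₁ D.refl))

  coincide⇒simple : (∀ x → ¬ IsSemiEdge x) → ParallelDartsCoincide → Simple
  coincide⇒simple noSemi coincide =
    noSemi ,
    (λ x (x≉x⁻¹ , b≈e) →
      coincide x (inv x) (b≈e , V.sym (V.trans (end-inv x) b≈e)) x≉x⁻¹) ,
    (λ x y (edges≢ , ends≐) →
      [ (λ x∥y   → coincide x y x∥y (edges≢ ∘ edge-≐ ∘ inj₁))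
      , (λ x∥y⁻¹ → coincide x (inv y) x∥y⁻¹ (edges≢ ∘ edge-≐ ∘ inj₂))
      ] (endvertices⇒Parallel ends≐))

module _ (G : Group c ℓ) where
  open Group G
  open Cosets G
  open GroupProperties G using (∙-cancelʳ; \\-leftDividesʳ)
  open ≈-Reasoning setoid

  ·-cancel : (H : Subgroup G p) {h g k : Carrier} →
             k ≈ h ∙ g → k ∈ H · g → h ∈ ∣ H ∣
  ·-cancel H {h} {g} k≈hg (a , a∈H , k≈ag) =
    Subgroup.respects H (∙-cancelʳ g a h (trans (sym k≈ag) k≈hg)) a∈H

  ·-≐ : (H K : Subgroup G p) {g k : Carrier} →
        ∣ H ∣ ≐ ∣ K ∣ → k ∈ K · g → H · k ≐ K · g
  ·-≐ H K (H⊆K , K⊆H) k∈Kg@(h , h∈K , k≈hg) =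
    ·-mono H K H⊆K k∈Kg ,
    ·-mono K H K⊆H (∈-swap H (h , K⊆H h∈K , k≈hg))

  -- With `z = ζ y` and `w = ζ x`, this compares the representatives at the ends of the cover darts
  -- `(y , h ∙ g)` and `(x , g)`: they differ on the left by exactly the element tested in (1) and
  -- (2).
  split-∙ : ∀ z h w g → z ∙ (h ∙ g) ≈ (z ∙ h ∙ w ⁻¹) ∙ (w ∙ g)
  split-∙ z h w g = begin
    z ∙ (h ∙ g)                  ≈⟨ assoc z h g ⟨
    (z ∙ h) ∙ g                  ≈⟨ ∙-congˡ (\\-leftDividesʳ w g) ⟨
    (z ∙ h) ∙ (w ⁻¹ ∙ (w ∙ g))   ≈⟨ assoc (z ∙ h) (w ⁻¹) (w ∙ g) ⟨
    (z ∙ h ∙ w ⁻¹) ∙ (w ∙ g)     ∎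

module _ {Δ : Graph v ℓv d ℓd} {G : Group c ℓ} (𝒱 : GenVoltageGraph Δ G p) where
  open Graph Δ
  open Group G
  open GenVoltageGraph 𝒱
  open Cosets G
  private
    module C = Graph (GenCov 𝒱)

  cover-Parallel⁺ : ∀ {x y} g {h} → Parallel y x → h ∈ ∣ ωⱽ (beg x) ∣ →
                    ζ y ∙ h ∙ ζ x ⁻¹ ∈ ∣ ωⱽ (end x) ∣ →
                    C.Parallel (y , h ∙ g) (x , g)
  cover-Parallel⁺ {x} {y} g {h} (b , e) h∈ω zhz∈ω =
    (b , ·-≐ G (ωⱽ (beg y)) (ωⱽ (beg x)) (ωⱽ-cong b) (h , h∈ω , refl)) ,
    (e , ·-≐ G (ωⱽ (end y)) (ωⱽ (end x)) (ωⱽ-cong e)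
           (_ , zhz∈ω , split-∙ G (ζ y) h (ζ x) g))

  -- Agreement of the beginnings supplies `h`; agreement of the ends, after cancelling `ζ x ∙ g` on
  -- the right, says where `ζ y ∙ h ∙ ζ x ⁻¹` lies.
  cover-Parallel⁻ : ∀ {x y g k} → C.Parallel (y , k) (x , g) →
                    Parallel y x × ∃ λ h → h ∈ ∣ ωⱽ (beg x) ∣ × k ≈ h ∙ g ×
                                           ζ y ∙ h ∙ ζ x ⁻¹ ∈ ∣ ωⱽ (end x) ∣
  cover-Parallel⁻ {x} {y} {g} {k} ((b , begs , _) , (e , ends , _))
    with h , h∈ω , k≈hg ← begs (∈-self (ωⱽ (beg y)) k) =
    (b , e) , h , h∈ω , k≈hg ,
    ·-cancel G (ωⱽ (end x))
      (trans (∙-congˡ k≈hg) (split-∙ G (ζ y) h (ζ x) g))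
      (ends (∈-self (ωⱽ (end y)) (ζ y ∙ k)))

  coset⇒∈ω : ∀ {x y h g} → (y , h ∙ g) C.≈ᴰ (x , g) → h ∈ ∣ ωᴰ x ∣
  coset⇒∈ω {x} {y} {h} {g} (_ , sub , _) =
    ·-cancel G (ωᴰ x) refl (sub (∈-self (ωᴰ y) (h ∙ g)))

  ∈ω⇒coset : ∀ {x y h g k} → y ≈ᴰ x → h ∈ ∣ ωᴰ x ∣ → k ≈ h ∙ g →
             (y , k) C.≈ᴰ (x , g)
  ∈ω⇒coset {x} {y} {h} y≈x h∈ω k≈hg =
    y≈x , ·-≐ G (ωᴰ y) (ωᴰ x) (ωᴰ-cong y≈x) (h , h∈ω , k≈hg)

theorem37 :
  {v ℓv d ℓd c ℓ p : Level}
  (Δ : Graph v ℓv d ℓd) (G : Group c ℓ) (𝒱 : GenVoltageGraph Δ G p) →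
  let open Graph Δ
      open Group G
      open GenVoltageGraph 𝒱
  in
  Graph.Simple (GenCov 𝒱) ⇔
  (∀ x →
    (∀ h → h ∈ ∣ ωⱽ (beg x) ∣ ∖ ∣ ωᴰ x ∣ → ζ x ∙ h ∙ ζ x ⁻¹ ∉ ∣ ωⱽ (end x) ∣)
    × (∀ y → ¬ (y ≈ᴰ x) → Parallel y x →
         ∀ h → h ∈ ∣ ωⱽ (beg x) ∣ → ζ y ∙ h ∙ ζ x ⁻¹ ∉ ∣ ωⱽ (end x) ∣)
    × (x ≈ᴰ inv x → ζ x ∉ ∣ ωᴰ x ∣))
theorem37 Δ G 𝒱 = mk⇔
  (λ simple x →
    let coincide = simple⇒coincide Γ simple in
    (λ h (h∈ω , h∉ω) zhz∈ω →
      -- The conditions mention no coset representative, so the darts over `x` and `y` are compared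
      -- in the fibres at `g = ε`.
      coincide (x , h ∙ ε) (x , ε)
        (cover-Parallel⁺ 𝒱 ε (V.refl , V.refl) h∈ω zhz∈ω)
        (h∉ω ∘ coset⇒∈ω 𝒱)) ,
    (λ y y≉x y∥x h h∈ω zhz∈ω →
      coincide (y , h ∙ ε) (x , ε)
        (cover-Parallel⁺ 𝒱 ε y∥x h∈ω zhz∈ω) (y≉x ∘ proj₁)) ,
    (λ x≈x⁻¹ ζ∈ω →
      -- The inverse of `(x , ε)` is `(inv x , ζ x ∙ ε)`, which is `(x , ε)` again once `ζ x` lies
      -- in `ωᴰ x`.
      proj₁ simple (x , ε)
        (C.sym {inv x , ζ x ∙ ε} {x , ε}
          (∈ω⇒coset 𝒱 (D.sym x≈x⁻¹) ζ∈ω refl))))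
  (λ conditions → coincide⇒simple Γ
    (λ (x , g) semi@(x≈x⁻¹ , _) →
      proj₂ (proj₂ (conditions x)) x≈x⁻¹
        (coset⇒∈ω 𝒱 (C.sym {x , g} {inv x , ζ x ∙ g} semi)))
    (λ (y , k) (x , g) Y∥X Y≉X →
      let y∥x , h , h∈ω , k≈hg , zhz∈ω = cover-Parallel⁻ 𝒱 Y∥X
          cond₁ , cond₂ , _ = conditions x
      in
      -- In place of deciding whether `y ≈ᴰ x`, the inequality required by (2) is derived from (1):
      -- if `y ≈ᴰ x`, then `h` lies outside `ωᴰ x`, since otherwise the two cover darts would
      -- coincide, and (1) gives a contradiction.
      cond₂ y
        (λ y≈x → cond₁ h
          (h∈ω , λ h∈ωx → Y≉X (∈ω⇒coset 𝒱 y≈x h∈ωx k≈hg))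
          (Subgroup.respects (ωⱽ (end x))
            (∙-congʳ (∙-congʳ (ζ-cong y≈x))) zhz∈ω))
        y∥x h h∈ω zhz∈ω))
  where
  open Graph Δ
  open Group G
  open GenVoltageGraph 𝒱
  Γ = GenCov 𝒱
  module V = Setoid vertexSetoid
  module D = Setoid dartSetoid
  module C = Setoid (Graph.dartSetoid Γ)
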